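{- Let $t\ge 1$, let $\ell_1,\dots,\ell_t$ be distinct positive integers and set $\mathcal L=\{2\ell_1,\dots,2\ell_t\}$. Then there exists $n_0=n_0(\mathcal L)$ such that, for every $n\ge n_0$, every family $\mathcal F\subseteq H=\{A\subseteq[n]: |A|\text{ is even}\}$ satisfying $|A\triangle B|\in\mathcal L$ for all $A\ne B$ in $\mathcal F$ has $$|\mathcal F|\le \sum_{i=0}^{t}\binom{n-1}{i}.$$ Moreover, for $\mathcal L=\{2,4,\dots,2t\}$, equality is attained: for every $n\ge n_0(\mathcal L)$ there is a family $\mathcal F\subseteq H$ with $|A\triangle B|\in\{2,4,\dots,2t\}$ for all $A\ne B$ in $\mathcal F$ and $|\mathcal F|=\sum_{i=0}^{t}\binom{n-1}{i}$.
   Context: Here $[n]=\{1,\dots,n\}$ and $\triangle$ denotes symmetric difference of sets. The set $H$ of even-size subsets of $[n]$ is called the even subcube. -}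

module Defs where

open import Data.Bool.Base using (_xor_)
open import Data.Fin.Base using (Fin; toℕ)
open import Data.Fin.Subset using (Subset; ∣_∣)
open import Data.List.Base using (List; length; map; upTo)
import Data.List.Membership.Propositional as List
open import Data.List.Relation.Unary.Unique.Propositional using (Unique)
open import Data.Nat.Base using (ℕ; suc; _*_; _∸_)
open import Data.Nat.Combinatorics using (_C_)
open import Data.Nat.ListAction using (sum)
open import Data.Nat.Divisibility using (_∣_)
open import Data.Product.Base using (∃-syntax)
open import Data.Vec.Base using (zipWith)
open import Level using (0ℓ)
open import Relation.Binary.PropositionalEquality using (_≡_; _≢_)
open import Relation.Unary using (Pred; _∈_)

infixr 6 _△_

_△_ : ∀ {n} → Subset n → Subset n → Subset n
A △ B = zipWith _xor_ A B

EvenSubcube : ∀ n → Pred (Subset n) 0ℓ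
EvenSubcube n A = 2 ∣ ∣ A ∣

-- A finite set of subsets, listed without repetition, so that the length of
-- the list is the cardinality of the family.
record Family (n : ℕ) : Set where
  field
    members  : List (Subset n)
    distinct : Unique members

  Members : Pred (Subset n) 0ℓ
  Members A = A List.∈ members

  size : ℕ
  size = length members

open Family public using (Members; size)

-- The set {2ℓ₁, …, 2ℓₜ}.
Doubles : ∀ {t} → (Fin t → ℕ) → Pred ℕ 0ℓ
Doubles ℓ d = ∃[ i ] d ≡ 2 * ℓ i

-- The set {2, 4, …, 2t}; the indices in Fin t run from 0 to t - 1.
FirstEvens : ∀ t → Pred ℕ 0ℓ
FirstEvens t = Doubles {t} (λ i → suc (toℕ i))

DistancesIn : ∀ {n} → Family n → Pred ℕ 0ℓ → Set
DistancesIn {n} F L =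
  ∀ {A B : Subset n} → A ∈ Members F → B ∈ Members F → A ≢ B → ∣ A △ B ∣ ∈ L

-- The sum of (n - 1) C i over 0 ≤ i ≤ t.  The
-- truncated subtraction n ∸ 1 differs from n - 1 only at n = 0.
binomialSum : ℕ → ℕ → ℕ
binomialSum n t = sum (map (λ i → (n ∸ 1) C i) (upTo (suc t)))

{-# OPTIONS --safe #-}

-- Write A as a ±1 vector x(A), so that z(A, B) = Σₖ xₖ(A) xₖ(B) = n - 2∣A △ B∣, and put aᵢ = n - 4ℓᵢ, which is
-- nonnegative for large n.  The kernel g = ∏ᵢ (z - aᵢ) vanishes off the diagonal of F and is positive on it, so
-- Q(c) = Σ c(A) c(B) g(A, B) is positive definite.  The signs in the expansion of g into powers of z alternate,
-- and every zʲ is a Gram kernel of characters χ_S with ∣S∣ ≤ j and ∣S∣ ≡ j mod 2.  Hence Q(c) ≤ 0 as soon as c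
-- is orthogonal to all χ_S with ∣S∣ ≤ t and ∣S∣ ≡ t mod 2.  Deleting the first coordinate puts these S in bijection
-- with the subsets of [n - 1] of size at most t, so if F had more than Σ_{i ≤ t} C(n - 1, i) members, a nonzero
-- such c would exist.  The even sets that delete to such subsets show that the bound is attained.

module Submission where

open import Defs
open import Data.Fin.Base using (Fin)
open import Data.Nat.Base using (ℕ; _≤_; _≥_)
open import Data.Product.Base using (_×_; ∃-syntax)
open import Function.Definitions using (Injective)
open import Relation.Binary.PropositionalEquality using (_≡_)
open import Relation.Unary using (_⊆_; _≐_)

import Algebra.Properties.Semiring.Sum
open import Data.Bool.Base using (Bool; true; false; if_then_else_; _∧_; _xor_)
open import Data.Bool.Properties using (∧-comm)
open import Data.Fin.Base using (fromℕ<; punchIn)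
open import Data.Fin.Patterns using (0F)
open import Data.Fin.Properties using (any?; toℕ-fromℕ<; punchInᵢ≢i)
open import Data.Fin.Subset using (Subset; ∣_∣; _∩_; ⁅_⁆; ⊥)
open import Data.Fin.Subset.Properties using (∣⁅x⁆∣≡1; ∣⊥∣≡0)
open import Data.Integer.Base as ℤ using (ℤ; -[1+_]; 0ℤ; 1ℤ; -1ℤ) renaming (+_ to pos)
import Data.Integer.Properties as ℤ
open import Data.Integer.Tactic.RingSolver using (solve-∀)
open import Data.List.Base as List using (List; []; _∷_; _++_; length; lookup; applyUpTo)
open import Data.List.Membership.Propositional using (_∈_)
open import Data.List.Membership.Propositional.Properties using (∈-lookup; ∈-map⁺; ∈-map⁻; ∈-++⁺ˡ; ∈-++⁺ʳ)
open import Data.List.Properties using (length-map; length-++; map-upTo)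
open import Data.List.Relation.Unary.All as All using (All; []; _∷_)
import Data.List.Relation.Unary.All.Properties as All
open import Data.List.Relation.Unary.AllPairs using ([]; _∷_)
open import Data.List.Relation.Unary.Any using (here)
open import Data.List.Relation.Unary.Unique.Propositional using (Unique)
import Data.List.Relation.Unary.Unique.Propositional.Properties as Unique
open import Data.Nat.Base as ℕ using (zero; suc; z≤n; s≤s; _+_; _*_; _<_)
open import Data.Nat.Combinatorics using (_C_; nCk+nC[k+1]≡[n+1]C[k+1])
open import Data.Nat.Divisibility as ℕ using (divides; _∣?_; ∣-refl; ∣m∣n⇒∣m+n; ∣m+n∣m⇒∣n; m∣m*n; ∣1⇒≡1)
open import Data.Nat.ListAction using (sum)
import Data.Nat.Properties as ℕ
open import Data.Nat.Tactic.RingSolver using () renaming (solve-∀ to solveℕ-∀)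
open import Data.Product.Base using (_,_)
open import Data.Sum.Base as Sum using (_⊎_; inj₁; inj₂)
open import Data.Vec.Base as Vec using ([]; _∷_)
import Data.Vec.Properties as Vec
open import Data.Vec.Functional using (Vector; insertAt)
open import Data.Vec.Functional.Properties using (insertAt-lookup; insertAt-punchIn)
open import Function.Base using (_∘_; id)
open import Relation.Binary.PropositionalEquality using (_≢_; _≗_)
open import Relation.Binary.PropositionalEquality using (refl; sym; trans; cong; cong₂; subst; module ≡-Reasoning)
open import Relation.Nullary using (¬_; yes; no; contradiction; ¬?; ⌊_⌋)
open import Relation.Nullary.Decidable using (decidable-stable)

module ∑ = Algebra.Properties.Semiring.Sum ℤ.+-*-semiring
open ∑ using (sum-syntax)

private
  variable
    k m n N p t : ℕ

-- Finite sums and sign rules over the integers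

∑-cong : {f g : Vector ℤ n} → f ≗ g → ∑.sum f ≡ ∑.sum g
∑-cong = ∑.sum-cong-≗

∑-zero : {f : Vector ℤ n} → (∀ i → f i ≡ 0ℤ) → ∑.sum f ≡ 0ℤ
∑-zero {n} f≡0 = trans (∑-cong f≡0) (∑.sum-replicate-zero n)

∑-nonNeg : {f : Vector ℤ n} → (∀ i → 0ℤ ℤ.≤ f i) → 0ℤ ℤ.≤ ∑.sum f
∑-nonNeg {zero}  0≤f = ℤ.≤-refl
∑-nonNeg {suc n} 0≤f = ℤ.+-mono-≤ (0≤f 0F) (∑-nonNeg (0≤f ∘ Fin.suc))

∑-nonPos : {f : Vector ℤ n} → (∀ i → f i ℤ.≤ 0ℤ) → ∑.sum f ℤ.≤ 0ℤ
∑-nonPos {zero}  f≤0 = ℤ.≤-refl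
∑-nonPos {suc n} f≤0 = ℤ.+-mono-≤ (f≤0 0F) (∑-nonPos (f≤0 ∘ Fin.suc))

∑-pos : {f : Vector ℤ n} → (∀ i → 0ℤ ℤ.≤ f i) → ∀ i → 0ℤ ℤ.< f i → 0ℤ ℤ.< ∑.sum f
∑-pos 0≤f Fin.zero    0<fi = ℤ.+-mono-<-≤ 0<fi (∑-nonNeg (0≤f ∘ Fin.suc))
∑-pos 0≤f (Fin.suc i) 0<fi = ℤ.+-mono-≤-< (0≤f 0F) (∑-pos (0≤f ∘ Fin.suc) i 0<fi)

∑-single : (f : Vector ℤ n) → ∀ i → (∀ j → i ≢ j → f j ≡ 0ℤ) → ∑.sum f ≡ f i
∑-single {suc n} f i f≡0 = begin
  ∑.sum f                             ≡⟨ ∑.sum-remove {i = i} f ⟩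
  f i ℤ.+ ∑.sum (λ j → f (punchIn i j)) ≡⟨ cong (λ z → f i ℤ.+ z) (∑-zero λ j → f≡0 _ (punchInᵢ≢i i j ∘ sym)) ⟩
  f i ℤ.+ 0ℤ                          ≡⟨ ℤ.+-identityʳ (f i) ⟩
  f i                                 ∎
  where open ≡-Reasoning

∑-linear : ∀ x y (f g : Vector ℤ n) →
  ∑[ i < n ] (x ℤ.* f i ℤ.+ y ℤ.* g i) ≡ x ℤ.* ∑.sum f ℤ.+ y ℤ.* ∑.sum g
∑-linear x y f g = trans (∑.∑-distrib-+ (λ i → x ℤ.* f i) (λ i → y ℤ.* g i))
  (sym (cong₂ ℤ._+_ (∑.*-distribˡ-sum x f) (∑.*-distribˡ-sum y g)))

0≤i*i : ∀ i → 0ℤ ℤ.≤ i ℤ.* i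
0≤i*i (pos n)    = subst (0ℤ ℤ.≤_) (ℤ.pos-* n n) (ℤ.+≤+ z≤n)
0≤i*i -[1+ n ] = ℤ.+≤+ z≤n

0≤i⇒0≤j⇒0≤i*j : ∀ {i j} → 0ℤ ℤ.≤ i → 0ℤ ℤ.≤ j → 0ℤ ℤ.≤ i ℤ.* j
0≤i⇒0≤j⇒0≤i*j {pos m} {pos n} _ _ = subst (0ℤ ℤ.≤_) (ℤ.pos-* m n) (ℤ.+≤+ z≤n)

0≤i⇒0≤j⇒-i*j≤0 : ∀ {i j} → 0ℤ ℤ.≤ i → 0ℤ ℤ.≤ j → (ℤ.- i) ℤ.* j ℤ.≤ 0ℤ
0≤i⇒0≤j⇒-i*j≤0 {i} {j} 0≤i 0≤j = subst (ℤ._≤ 0ℤ) (ℤ.neg-distribˡ-* i j) (ℤ.neg-mono-≤ (0≤i⇒0≤j⇒0≤i*j 0≤i 0≤j))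

0≤i⇒j≤0⇒0≤-i*j : ∀ {i j} → 0ℤ ℤ.≤ i → j ℤ.≤ 0ℤ → 0ℤ ℤ.≤ (ℤ.- i) ℤ.* j
0≤i⇒j≤0⇒0≤-i*j {i} {j} 0≤i j≤0 = subst (0ℤ ℤ.≤_)
  (trans (sym (ℤ.neg-distribʳ-* i j)) (ℤ.neg-distribˡ-* i j)) (0≤i⇒0≤j⇒0≤i*j 0≤i (ℤ.neg-mono-≤ j≤0))

0≤i⇒i≢0⇒0<i : ∀ {i} → 0ℤ ℤ.≤ i → i ≢ 0ℤ → 0ℤ ℤ.< i
0≤i⇒i≢0⇒0<i 0≤i i≢0 = ℤ.≤∧≢⇒< 0≤i (i≢0 ∘ sym)

i≢0⇒j≢0⇒i*j≢0 : ∀ {i j} → i ≢ 0ℤ → j ≢ 0ℤ → i ℤ.* j ≢ 0ℤ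
i≢0⇒j≢0⇒i*j≢0 {i} i≢0 j≢0 = Sum.[ i≢0 , j≢0 ]′ ∘ ℤ.i*j≡0⇒i≡0∨j≡0 i

-- Underdetermined homogeneous linear systems

infix 8 _·_

_·_ : Vector ℤ n → Vector ℤ n → ℤ
_·_ {n} u v = ∑[ i < n ] (u i ℤ.* v i)

module _ (r : Vector ℤ (suc n)) (i : Fin (suc n)) where

  -- Fraction-free Gaussian elimination: cross-multiplying with the pivot `r i` cancels column `i`
  -- without leaving the integers.
  eliminate : Vector ℤ (suc n) → Vector ℤ n
  eliminate s j = r i ℤ.* s (punchIn i j) ℤ.- s i ℤ.* r (punchIn i j)

  -- Solves the pivot equation for coordinate `i`; scaling the other coordinates by `r i` keeps the
  -- solution integral.
  backSubstitute : Vector ℤ n → Vector ℤ (suc n)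
  backSubstitute c = insertAt (λ j → r i ℤ.* c j) i (ℤ.- ((r ∘ punchIn i) · c))

  ·-backSubstitute : ∀ s c → s · backSubstitute c ≡ eliminate s · c
  ·-backSubstitute s c = begin
    s · backSubstitute c
      ≡⟨ ∑.sum-remove {i = i} (λ j → s j ℤ.* backSubstitute c j) ⟩
    s i ℤ.* backSubstitute c i ℤ.+ ∑[ j < n ] (s (punchIn i j) ℤ.* backSubstitute c (punchIn i j))
      ≡⟨ cong₂ ℤ._+_ (cong (s i ℤ.*_) (insertAt-lookup _ i _))
           (∑-cong λ j → trans (cong (s (punchIn i j) ℤ.*_) (insertAt-punchIn _ i _ j)) (swap (s (punchIn i j)) (r i) (c j))) ⟩
    s i ℤ.* (ℤ.- ((r ∘ punchIn i) · c)) ℤ.+ ∑[ j < n ] (r i ℤ.* (s (punchIn i j) ℤ.* c j))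
      ≡⟨ cong (λ z → s i ℤ.* (ℤ.- ((r ∘ punchIn i) · c)) ℤ.+ z) (sym (∑.*-distribˡ-sum (r i) (λ j → s (punchIn i j) ℤ.* c j))) ⟩
    s i ℤ.* (ℤ.- ((r ∘ punchIn i) · c)) ℤ.+ r i ℤ.* (s ∘ punchIn i) · c
      ≡⟨ rearrange (s i) ((r ∘ punchIn i) · c) (r i) ((s ∘ punchIn i) · c) ⟩
    r i ℤ.* (s ∘ punchIn i) · c ℤ.+ (ℤ.- s i) ℤ.* (r ∘ punchIn i) · c
      ≡⟨ ∑-linear (r i) (ℤ.- s i) (λ j → s (punchIn i j) ℤ.* c j) (λ j → r (punchIn i j) ℤ.* c j) ⟨
    ∑[ j < n ] (r i ℤ.* (s (punchIn i j) ℤ.* c j) ℤ.+ (ℤ.- s i) ℤ.* (r (punchIn i j) ℤ.* c j))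
      ≡⟨ ∑-cong (λ j → factor (r i) (s (punchIn i j)) (c j) (s i) (r (punchIn i j))) ⟩
    eliminate s · c ∎
    where
    open ≡-Reasoning
    swap : ∀ x y z → x ℤ.* (y ℤ.* z) ≡ y ℤ.* (x ℤ.* z)
    swap = solve-∀
    rearrange : ∀ x y z w → x ℤ.* (ℤ.- y) ℤ.+ z ℤ.* w ≡ z ℤ.* w ℤ.+ (ℤ.- x) ℤ.* y
    rearrange = solve-∀
    factor : ∀ x y z w v → x ℤ.* (y ℤ.* z) ℤ.+ (ℤ.- w) ℤ.* (v ℤ.* z) ≡ (x ℤ.* y ℤ.- w ℤ.* v) ℤ.* z
    factor = solve-∀

  eliminate-pivot : ∀ c → eliminate r · c ≡ 0ℤ
  eliminate-pivot c = ∑-zero λ j → trans (cong (ℤ._* c j) (ℤ.+-inverseʳ (r i ℤ.* r (punchIn i j)))) (ℤ.*-zeroˡ (c j))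

zero⊎pivot : (r : Vector ℤ N) → (∀ i → r i ≡ 0ℤ) ⊎ (∃[ i ] r i ≢ 0ℤ)
zero⊎pivot r with any? (λ i → ¬? (r i ℤ.≟ 0ℤ))
... | yes pivot = inj₂ pivot
... | no ∄pivot = inj₁ λ i → decidable-stable (r i ℤ.≟ 0ℤ) (λ ri≢0 → ∄pivot (i , ri≢0))

-- A zero row imposes no condition and is dropped with `N` kept. Any other row has a pivot, and
-- eliminating it lowers both the number of rows and the number of unknowns by one.
∃-orthogonal : (rows : List (Vector ℤ N)) → length rows < N →
  ∃[ c ] (∃[ i ] c i ≢ 0ℤ) × All (λ r → r · c ≡ 0ℤ) rows
∃-orthogonal {zero}  _          ()
∃-orthogonal {suc N} []         _      = (λ _ → 1ℤ) , (0F , λ ()) , []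
∃-orthogonal {suc N} (r ∷ rows) rows<N = Sum.[
  (λ r≡0 →
    let c , c≢0 , rows⊥c = ∃-orthogonal rows (ℕ.m<n⇒m<1+n (ℕ.≤-pred rows<N))
    in c , c≢0 , ∑-zero (λ i → trans (cong (ℤ._* c i) (r≡0 i)) (ℤ.*-zeroˡ (c i))) ∷ rows⊥c) ,
  (λ (i , ri≢0) →
    let c , (j , cj≢0) , rows⊥c = ∃-orthogonal (List.map (eliminate r i) rows)
                                    (subst (_< N) (sym (length-map _ rows)) (ℕ.≤-pred rows<N))
    in backSubstitute r i c ,
       -- Away from the pivot the entries are only scaled by `r i`, so a nonzero entry of `c`
       -- survives.
       (punchIn i j , i≢0⇒j≢0⇒i*j≢0 ri≢0 cj≢0 ∘ trans (sym (insertAt-punchIn _ i _ j))) ,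
       trans (·-backSubstitute r i r c) (eliminate-pivot r i c) ∷
       All.map (λ {s} → trans (·-backSubstitute r i s c)) (All.map⁻ rows⊥c)) ]′
  (zero⊎pivot r)

-- Symmetric differences

Even : ℕ → Set
Even n = 2 ℕ.∣ n

∣△∣+2∣∩∣ : (A B : Subset n) → ∣ A △ B ∣ + 2 * ∣ A ∩ B ∣ ≡ ∣ A ∣ + ∣ B ∣
∣△∣+2∣∩∣ []          []          = refl
∣△∣+2∣∩∣ (false ∷ A) (false ∷ B) = ∣△∣+2∣∩∣ A B
∣△∣+2∣∩∣ (false ∷ A) (true  ∷ B) = trans (cong suc (∣△∣+2∣∩∣ A B)) (sym (ℕ.+-suc ∣ A ∣ ∣ B ∣))
∣△∣+2∣∩∣ (true  ∷ A) (false ∷ B) = cong suc (∣△∣+2∣∩∣ A B)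
∣△∣+2∣∩∣ (true  ∷ A) (true  ∷ B) = begin
  ∣ A △ B ∣ + 2 * suc ∣ A ∩ B ∣     ≡⟨ shift ∣ A △ B ∣ ∣ A ∩ B ∣ ⟩
  2 + (∣ A △ B ∣ + 2 * ∣ A ∩ B ∣)   ≡⟨ cong (λ x → 2 + x) (∣△∣+2∣∩∣ A B) ⟩
  2 + (∣ A ∣ + ∣ B ∣)               ≡⟨ cong suc (sym (ℕ.+-suc ∣ A ∣ ∣ B ∣)) ⟩
  suc ∣ A ∣ + suc ∣ B ∣             ∎
  where
  open ≡-Reasoning
  shift : ∀ x y → x + 2 * suc y ≡ 2 + (x + 2 * y)
  shift = solveℕ-∀

∣△∣≤ : (A B : Subset n) → ∣ A △ B ∣ ≤ ∣ A ∣ + ∣ B ∣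
∣△∣≤ A B = subst (∣ A △ B ∣ ≤_) (∣△∣+2∣∩∣ A B) (ℕ.m≤m+n ∣ A △ B ∣ _)

-- The offset `p` prescribes a parity: `p + ∣ S ∣` is even exactly when `∣ S ∣` and `p` agree modulo
-- 2. The sizes of `A △ B` and of `A` and `B` together differ by twice the intersection, which
-- preserves parity.
2∣p+∣△∣ : ∀ p (A B : Subset n) → Even (p + (∣ A ∣ + ∣ B ∣)) → Even (p + ∣ A △ B ∣)
2∣p+∣△∣ p A B 2∣ = ∣m+n∣m⇒∣n {n = p + ∣ A △ B ∣} (subst Even eq 2∣) (m∣m*n ∣ A ∩ B ∣)
  where
  open ≡-Reasoning
  eq : p + (∣ A ∣ + ∣ B ∣) ≡ 2 * ∣ A ∩ B ∣ + (p + ∣ A △ B ∣)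
  eq = begin
    p + (∣ A ∣ + ∣ B ∣)                 ≡⟨ cong (p +_) (∣△∣+2∣∩∣ A B) ⟨
    p + (∣ A △ B ∣ + 2 * ∣ A ∩ B ∣)     ≡⟨ ℕ.+-assoc p _ _ ⟨
    p + ∣ A △ B ∣ + 2 * ∣ A ∩ B ∣       ≡⟨ ℕ.+-comm (p + ∣ A △ B ∣) _ ⟩
    2 * ∣ A ∩ B ∣ + (p + ∣ A △ B ∣)     ∎

∣A△A∣≡0 : (A : Subset n) → ∣ A △ A ∣ ≡ 0
∣A△A∣≡0 []          = refl
∣A△A∣≡0 (false ∷ A) = ∣A△A∣≡0 A
∣A△A∣≡0 (true  ∷ A) = ∣A△A∣≡0 A

∣△∣≡0⇒≡ : (A B : Subset n) → ∣ A △ B ∣ ≡ 0 → A ≡ B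
∣△∣≡0⇒≡ []          []          _ = refl
∣△∣≡0⇒≡ (false ∷ A) (false ∷ B) d = cong (false ∷_) (∣△∣≡0⇒≡ A B d)
∣△∣≡0⇒≡ (true  ∷ A) (true  ∷ B) d = cong (true ∷_) (∣△∣≡0⇒≡ A B d)

2∣n⊎2∣1+n : ∀ n → Even n ⊎ Even (suc n)
2∣n⊎2∣1+n zero    = inj₁ (divides 0 refl)
2∣n⊎2∣1+n (suc n) = Sum.swap (Sum.map₁ (∣m∣n⇒∣m+n ∣-refl) (2∣n⊎2∣1+n n))

2∣n⇒2∤1+n : Even n → ¬ Even (suc n)
2∣n⇒2∤1+n {n} 2∣n 2∣1+n with () ← ∣1⇒≡1 (∣m+n∣m⇒∣n (subst Even (ℕ.+-comm 1 n) 2∣1+n) 2∣n)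

-- Small subsets, and their extensions of prescribed parity

smallSubsets : ∀ m → ℕ → List (Subset m)
smallSubsets zero    k       = [] ∷ []
smallSubsets (suc m) zero    = List.map (false ∷_) (smallSubsets m zero)
smallSubsets (suc m) (suc k) = List.map (false ∷_) (smallSubsets m (suc k)) ++ List.map (true ∷_) (smallSubsets m k)

∈-smallSubsets⁺ : (S : Subset m) → ∣ S ∣ ≤ k → S ∈ smallSubsets m k
∈-smallSubsets⁺                 []          _         = here refl
∈-smallSubsets⁺ {k = zero}      (false ∷ S) S≤k       = ∈-map⁺ (false ∷_) (∈-smallSubsets⁺ S S≤k)
∈-smallSubsets⁺ {k = suc k}     (false ∷ S) S≤k       = ∈-++⁺ˡ (∈-map⁺ (false ∷_) (∈-smallSubsets⁺ S S≤k))
∈-smallSubsets⁺ {k = suc k}     (true  ∷ S) (s≤s S≤k) = ∈-++⁺ʳ _ (∈-map⁺ (true ∷_) (∈-smallSubsets⁺ S S≤k))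

smallSubsets-small : ∀ m k → All (λ S → ∣ S ∣ ≤ k) (smallSubsets m k)
smallSubsets-small zero    k       = z≤n ∷ []
smallSubsets-small (suc m) zero    = All.map⁺ (smallSubsets-small m zero)
smallSubsets-small (suc m) (suc k) = All.++⁺ (All.map⁺ (smallSubsets-small m (suc k)))
                                             (All.map⁺ (All.map s≤s (smallSubsets-small m k)))

smallSubsets-unique : ∀ m k → Unique (smallSubsets m k)
smallSubsets-unique zero    k       = [] ∷ []
smallSubsets-unique (suc m) zero    = Unique.map⁺ Vec.∷-injectiveʳ (smallSubsets-unique m zero)
smallSubsets-unique (suc m) (suc k) = Unique.++⁺
  (Unique.map⁺ Vec.∷-injectiveʳ (smallSubsets-unique m (suc k)))
  (Unique.map⁺ Vec.∷-injectiveʳ (smallSubsets-unique m k))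
  disjoint
  where
  disjoint : ∀ {S} → ¬ (S ∈ List.map (false ∷_) (smallSubsets m (suc k)) × S ∈ List.map (true ∷_) (smallSubsets m k))
  disjoint (S∈ , S∈′) with ∈-map⁻ (false ∷_) S∈ | ∈-map⁻ (true ∷_) S∈′
  ... | _ , _ , refl | _ , _ , ()

sum-applyUpTo-+ : ∀ (f g : ℕ → ℕ) n →
  sum (applyUpTo f n) + sum (applyUpTo g n) ≡ sum (applyUpTo (λ i → f i + g i) n)
sum-applyUpTo-+ f g zero    = refl
sum-applyUpTo-+ f g (suc n) = trans
  (interchange (f 0) (sum (applyUpTo (f ∘ suc) n)) (g 0) (sum (applyUpTo (g ∘ suc) n)))
  (cong (λ x → f 0 + g 0 + x) (sum-applyUpTo-+ (f ∘ suc) (g ∘ suc) n))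
  where
  interchange : ∀ a b c d → a + b + (c + d) ≡ a + c + (b + d)
  interchange = solveℕ-∀

applyUpTo-cong : ∀ {f g : ℕ → ℕ} → f ≗ g → ∀ n → applyUpTo f n ≡ applyUpTo g n
applyUpTo-cong f≗g zero    = refl
applyUpTo-cong f≗g (suc n) = cong₂ _∷_ (f≗g 0) (applyUpTo-cong (f≗g ∘ suc) n)

-- Pascal's rule, applied termwise after splitting on the first coordinate. The argument `suc m`
-- cancels the `n ∸ 1` in `binomialSum`.
length-smallSubsets : ∀ m k → length (smallSubsets m k) ≡ binomialSum (suc m) k
length-smallSubsets m k = trans (go m k) (cong sum (sym (map-upTo (m C_) (suc k))))
  where
  open ≡-Reasoning
  go : ∀ m k → length (smallSubsets m k) ≡ sum (applyUpTo (m C_) (suc k))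
  go zero    zero    = refl
  go zero    (suc k) = cong suc (go₀ (suc k) (λ _ → refl))
    where
    go₀ : ∀ k {f : ℕ → ℕ} → (∀ i → f i ≡ 0) → 0 ≡ sum (applyUpTo f k)
    go₀ zero    f≡0 = refl
    go₀ (suc k) f≡0 = cong₂ _+_ (sym (f≡0 0)) (go₀ k (f≡0 ∘ suc))
  go (suc m) zero    = trans (length-map _ (smallSubsets m zero)) (go m zero)
  go (suc m) (suc k) = begin
    length (smallSubsets (suc m) (suc k))
      ≡⟨ length-++ (List.map (false ∷_) (smallSubsets m (suc k))) ⟩
    length (List.map (false ∷_) (smallSubsets m (suc k))) + length (List.map (true ∷_) (smallSubsets m k))
      ≡⟨ cong₂ _+_ (length-map _ (smallSubsets m (suc k))) (length-map _ (smallSubsets m k)) ⟩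
    length (smallSubsets m (suc k)) + length (smallSubsets m k)
      ≡⟨ cong₂ _+_ (go m (suc k)) (go m k) ⟩
    1 + sum (applyUpTo (λ i → m C suc i) (suc k)) + sum (applyUpTo (m C_) (suc k))
      ≡⟨ cong suc (sum-applyUpTo-+ (λ i → m C suc i) (m C_) (suc k)) ⟩
    1 + sum (applyUpTo (λ i → m C suc i + m C i) (suc k))
      ≡⟨ cong (λ l → 1 + sum l) (applyUpTo-cong (λ i → trans (ℕ.+-comm (m C suc i) (m C i)) (nCk+nC[k+1]≡[n+1]C[k+1] m i)) (suc k)) ⟩
    sum (applyUpTo (suc m C_) (suc (suc k))) ∎

-- The first coordinate corrects the parity. Offset `t` indexes the characters of the upper bound,
-- and offset 0 gives the extremal family.
extend : ℕ → Subset m → Subset (suc m)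
extend p S = ⌊ 2 ∣? suc (p + ∣ S ∣) ⌋ ∷ S

2∣p+∣extend∣ : ∀ p (S : Subset m) → Even (p + ∣ extend p S ∣)
2∣p+∣extend∣ p S with 2 ∣? suc (p + ∣ S ∣)
... | yes 2∣ = subst Even (sym (ℕ.+-suc p ∣ S ∣)) 2∣
... | no 2∤  = Sum.[ id , (λ 2∣ → contradiction 2∣ 2∤) ]′ (2∣n⊎2∣1+n (p + ∣ S ∣))

-- Within one parity class the first coordinate is determined by the others, so deleting it loses
-- nothing.
extend-unique : ∀ p b (S : Subset m) → Even (p + ∣ b ∷ S ∣) → b ∷ S ≡ extend p S
extend-unique p b S 2∣ with 2 ∣? suc (p + ∣ S ∣) | b
... | yes _  | true  = refl
... | yes 2∣′ | false = contradiction 2∣′ (2∣n⇒2∤1+n 2∣)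
... | no 2∤  | true  = contradiction (subst Even (ℕ.+-suc p ∣ S ∣) 2∣) 2∤
... | no _   | false = refl

-- Characters of the cube

sign : Bool → ℤ
sign b = if b then -1ℤ else 1ℤ

-- The Walsh character: -1 to the power `∣ S ∩ A ∣`.
χ : Subset n → Subset n → ℤ
χ []      []      = 1ℤ
χ (s ∷ S) (a ∷ A) = sign (s ∧ a) ℤ.* χ S A

χ-comm : (S A : Subset n) → χ S A ≡ χ A S
χ-comm []      []      = refl
χ-comm (s ∷ S) (a ∷ A) = cong₂ (λ b → sign b ℤ.*_) (∧-comm s a) (χ-comm S A)

sign-∧-xor : ∀ s t a → sign ((s xor t) ∧ a) ≡ sign (s ∧ a) ℤ.* sign (t ∧ a)
sign-∧-xor false false a     = refl
sign-∧-xor false true  a     = sym (ℤ.*-identityˡ (sign a))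
sign-∧-xor true  false a     = sym (ℤ.*-identityʳ (sign a))
sign-∧-xor true  true  false = refl
sign-∧-xor true  true  true  = refl

χ-△ˡ : (S T A : Subset n) → χ (S △ T) A ≡ χ S A ℤ.* χ T A
χ-△ˡ []      []      []      = refl
χ-△ˡ (s ∷ S) (t ∷ T) (a ∷ A) = trans (cong₂ ℤ._*_ (sign-∧-xor s t a) (χ-△ˡ S T A))
  (interchange (sign (s ∧ a)) (sign (t ∧ a)) (χ S A) (χ T A))
  where
  interchange : ∀ x y z w → x ℤ.* y ℤ.* (z ℤ.* w) ≡ x ℤ.* z ℤ.* (y ℤ.* w)
  interchange = solve-∀

χ-△ʳ : (S A B : Subset n) → χ S (A △ B) ≡ χ S A ℤ.* χ S B
χ-△ʳ S A B = trans (χ-comm S (A △ B)) (trans (χ-△ˡ A B S) (cong₂ ℤ._*_ (χ-comm A S) (χ-comm B S)))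

χ-⊥ : (A : Subset n) → χ ⊥ A ≡ 1ℤ
χ-⊥ []      = refl
χ-⊥ (a ∷ A) = trans (ℤ.*-identityˡ (χ ⊥ A)) (χ-⊥ A)

-- The character of a singleton is a ±1 coordinate of `A`, equal to -1 exactly on the elements of
-- `A`.
∑χ-singletons : (A : Subset n) → ∑[ x < n ] χ ⁅ x ⁆ A ≡ pos n ℤ.- pos (2 * ∣ A ∣)
∑χ-singletons {n = zero}  []      = refl
∑χ-singletons {n = suc n} (a ∷ A) = begin
  sign a ℤ.* χ ⊥ A ℤ.+ ∑[ x < n ] (1ℤ ℤ.* χ ⁅ x ⁆ A)
    ≡⟨ cong₂ ℤ._+_ (trans (cong (sign a ℤ.*_) (χ-⊥ A)) (ℤ.*-identityʳ (sign a)))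
                   (trans (∑-cong {n = n} λ x → ℤ.*-identityˡ (χ ⁅ x ⁆ A)) (∑χ-singletons A)) ⟩
  sign a ℤ.+ (pos n ℤ.- pos (2 * ∣ A ∣))
    ≡⟨ step a ⟩
  pos (suc n) ℤ.- pos (2 * ∣ a ∷ A ∣) ∎
  where
  open ≡-Reasoning
  step : ∀ a → sign a ℤ.+ (pos n ℤ.- pos (2 * ∣ A ∣)) ≡ pos (suc n) ℤ.- pos (2 * ∣ a ∷ A ∣)
  step false = lemma (pos n) (pos (2 * ∣ A ∣))
    where
    lemma : ∀ x y → 1ℤ ℤ.+ (x ℤ.- y) ≡ 1ℤ ℤ.+ x ℤ.- y
    lemma = solve-∀
  step true = trans (lemma (pos n) (pos (2 * ∣ A ∣))) (cong (λ x → pos (suc n) ℤ.- pos x) (sym (ℕ.*-suc 2 ∣ A ∣)))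
    where
    lemma : ∀ x y → -1ℤ ℤ.+ (x ℤ.- y) ≡ 1ℤ ℤ.+ x ℤ.- (pos 2 ℤ.+ y)
    lemma = solve-∀

-- The annihilator polynomial

annihilator : Vector ℤ t → ℤ → ℤ
annihilator {zero}  a z = 1ℤ
annihilator {suc t} a z = (z ℤ.- a 0F) ℤ.* annihilator (a ∘ Fin.suc) z

annihilator-root : (a : Vector ℤ t) → ∀ i {z} → z ≡ a i → annihilator a z ≡ 0ℤ
annihilator-root a Fin.zero    refl = trans (cong (ℤ._* annihilator (a ∘ Fin.suc) (a 0F)) (ℤ.+-inverseʳ (a 0F)))
  (ℤ.*-zeroˡ (annihilator (a ∘ Fin.suc) (a 0F)))
annihilator-root a (Fin.suc i) {z} z≡ = trans (cong ((z ℤ.- a 0F) ℤ.*_) (annihilator-root (a ∘ Fin.suc) i z≡)) (ℤ.*-zeroʳ (z ℤ.- a 0F))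

annihilator-pos : (a : Vector ℤ t) → ∀ {z} → (∀ i → a i ℤ.< z) → 0ℤ ℤ.< annihilator a z
annihilator-pos {zero}  a     a<z = ℤ.+<+ (s≤s z≤n)
annihilator-pos {suc t} a {z} a<z = 0≤i⇒i≢0⇒0<i
  (0≤i⇒0≤j⇒0≤i*j (ℤ.<⇒≤ 0<z-a) (ℤ.<⇒≤ 0<rest))
  (i≢0⇒j≢0⇒i*j≢0 (ℤ.<⇒≢ 0<z-a ∘ sym) (ℤ.<⇒≢ 0<rest ∘ sym))
  where
  0<z-a : 0ℤ ℤ.< z ℤ.- a 0F
  0<z-a = subst (ℤ._< z ℤ.- a 0F) (ℤ.+-inverseʳ (a 0F)) (ℤ.+-monoˡ-< (ℤ.- a 0F) (a<z 0F))
  0<rest = annihilator-pos (a ∘ Fin.suc) (a<z ∘ Fin.suc)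

-- Quadratic forms

quad : Vector ℤ N → (Fin N → Fin N → ℤ) → ℤ
quad {N} c g = ∑[ i < N ] ∑[ j < N ] (c i ℤ.* c j ℤ.* g i j)

quad-one : (c : Vector ℤ N) → quad c (λ _ _ → 1ℤ) ≡ ∑.sum c ℤ.* ∑.sum c
quad-one {N} c = begin
  ∑[ i < N ] ∑[ j < N ] (c i ℤ.* c j ℤ.* 1ℤ)
    ≡⟨ ∑-cong {N} (λ i → trans (∑-cong {N} λ j → ℤ.*-identityʳ (c i ℤ.* c j)) (sym (∑.*-distribˡ-sum (c i) c))) ⟩
  ∑[ i < N ] (c i ℤ.* ∑.sum c)
    ≡⟨ ∑.*-distribʳ-sum (∑.sum c) c ⟨
  ∑.sum c ℤ.* ∑.sum c ∎
  where open ≡-Reasoning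

-- Only the diagonal survives, leaving a sum of squares with positive weights.
quad-diagonal-pos : ∀ (c : Vector ℤ N) g → (∀ i j → i ≢ j → g i j ≡ 0ℤ) → (∀ i → 0ℤ ℤ.< g i i) →
  ∀ i → c i ≢ 0ℤ → 0ℤ ℤ.< quad c g
quad-diagonal-pos {N} c g off diag i ci≢0 = subst (0ℤ ℤ.<_) (sym diagonal)
  (∑-pos {N} (λ j → 0≤i⇒0≤j⇒0≤i*j (0≤i*i (c j)) (ℤ.<⇒≤ (diag j))) i
    (0≤i⇒i≢0⇒0<i (0≤i⇒0≤j⇒0≤i*j (0≤i*i (c i)) (ℤ.<⇒≤ (diag i)))
      (i≢0⇒j≢0⇒i*j≢0 (i≢0⇒j≢0⇒i*j≢0 ci≢0 ci≢0) (ℤ.<⇒≢ (diag i) ∘ sym))))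
  where
  diagonal : quad c g ≡ ∑[ i < N ] (c i ℤ.* c i ℤ.* g i i)
  diagonal = ∑-cong {N} λ i → ∑-single {N} _ i λ j i≢j →
    trans (cong (c i ℤ.* c j ℤ.*_) (off i j i≢j)) (ℤ.*-zeroʳ (c i ℤ.* c j))

-- Each rank-one kernel `u x i ℤ.* u x j` is absorbed into the coefficients, replacing `c` by its
-- pointwise product with `u x`. This gives the induction step over the factors of the annihilator.
quad-Gram : ∀ (u : Fin n → Vector ℤ N) α c g →
  quad c (λ i j → (∑[ x < n ] (u x i ℤ.* u x j) ℤ.- α) ℤ.* g i j) ≡
  ∑[ x < n ] quad (λ i → u x i ℤ.* c i) g ℤ.+ (ℤ.- α) ℤ.* quad c g
quad-Gram {n} {N} u α c g = begin
  ∑[ i < N ] ∑[ j < N ] (c i ℤ.* c j ℤ.* ((∑[ x < n ] (u x i ℤ.* u x j) ℤ.- α) ℤ.* g i j))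
    ≡⟨ ∑-cong {N} (λ i → trans (∑-cong {N} (entry i)) (∑-+-* {N} _ _)) ⟩
  ∑[ i < N ] (∑[ j < N ] ∑[ x < n ] w x i j ℤ.+ (ℤ.- α) ℤ.* ∑[ j < N ] (c i ℤ.* c j ℤ.* g i j))
    ≡⟨ ∑-+-* {N} _ _ ⟩
  ∑[ i < N ] ∑[ j < N ] ∑[ x < n ] w x i j ℤ.+ (ℤ.- α) ℤ.* quad c g
    ≡⟨ cong (ℤ._+ (ℤ.- α) ℤ.* quad c g) (trans
         (∑-cong {N} λ i → ∑.∑-comm {N} {n} (λ j x → w x i j))
         (∑.∑-comm {N} {n} (λ i x → ∑[ j < N ] w x i j))) ⟩
  ∑[ x < n ] quad (λ i → u x i ℤ.* c i) g ℤ.+ (ℤ.- α) ℤ.* quad c g ∎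
  where
  open ≡-Reasoning
  w : Fin n → Fin N → Fin N → ℤ
  w x i j = u x i ℤ.* c i ℤ.* (u x j ℤ.* c j) ℤ.* g i j
  ∑-+-* : ∀ {M} (f h : Vector ℤ M) → ∑[ i < M ] (f i ℤ.+ (ℤ.- α) ℤ.* h i) ≡ ∑.sum f ℤ.+ (ℤ.- α) ℤ.* ∑.sum h
  ∑-+-* f h = trans (∑.∑-distrib-+ f (λ i → (ℤ.- α) ℤ.* h i)) (cong (λ z → ∑.sum f ℤ.+ z) (sym (∑.*-distribˡ-sum (ℤ.- α) h)))
  expand : ∀ a b s α g → a ℤ.* b ℤ.* ((s ℤ.- α) ℤ.* g) ≡ a ℤ.* b ℤ.* g ℤ.* s ℤ.+ (ℤ.- α) ℤ.* (a ℤ.* b ℤ.* g)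
  expand = solve-∀
  regroup : ∀ a b g x y → a ℤ.* b ℤ.* g ℤ.* (x ℤ.* y) ≡ x ℤ.* a ℤ.* (y ℤ.* b) ℤ.* g
  regroup = solve-∀
  entry : ∀ i j → c i ℤ.* c j ℤ.* ((∑[ x < n ] (u x i ℤ.* u x j) ℤ.- α) ℤ.* g i j) ≡
                  ∑[ x < n ] w x i j ℤ.+ (ℤ.- α) ℤ.* (c i ℤ.* c j ℤ.* g i j)
  entry i j = trans (expand (c i) (c j) (∑[ x < n ] (u x i ℤ.* u x j)) α (g i j))
    (cong (ℤ._+ (ℤ.- α) ℤ.* (c i ℤ.* c j ℤ.* g i j))
      (trans (∑.*-distribˡ-sum (c i ℤ.* c j ℤ.* g i j) (λ x → u x i ℤ.* u x j))
             (∑-cong {n} λ x → regroup (c i) (c j) (g i j) (u x i) (u x j))))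

-- Orthogonality to low-degree characters and the sign of the annihilator form

module _ (A : Fin N → Subset n) where

  character : Subset n → Vector ℤ N
  character S i = χ S (A i)

  -- The characters concerned have degree below `k` and the parity of `p`. With the strict bound,
  -- `k = 0` means no condition, which fits the base case of the nonnegative form.
  Orthogonal : ℕ → ℕ → Vector ℤ N → Set
  Orthogonal k p c = ∀ S → ∣ S ∣ < k → Even (p + ∣ S ∣) → character S · c ≡ 0ℤ

  twist : Fin n → Vector ℤ N → Vector ℤ N
  twist x c i = character ⁅ x ⁆ i ℤ.* c i

  Orthogonal-≤ : ∀ {k l p c} → k ≤ l → Orthogonal l p c → Orthogonal k p c
  Orthogonal-≤ k≤l c⊥ S S<k = c⊥ S (ℕ.≤-trans S<k k≤l)

  Orthogonal-parity : ∀ {k p c} → Orthogonal k (2 + p) c → Orthogonal k p c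
  Orthogonal-parity c⊥ S S<k 2∣ = c⊥ S S<k (∣m∣n⇒∣m+n ∣-refl 2∣)

  -- Twisting by `x` moves the test from `S` to `⁅ x ⁆ △ S`, whose size is at most one larger and of
  -- the opposite parity.
  Orthogonal-twist : ∀ {k p c} x → Orthogonal (suc k) p c → Orthogonal k (suc p) (twist x c)
  Orthogonal-twist {k} {p} {c} x c⊥ S S<k 2∣ = trans
    (∑-cong {N} λ i → trans (regroup (χ S (A i)) (χ ⁅ x ⁆ (A i)) (c i)) (cong (ℤ._* c i) (sym (χ-△ˡ ⁅ x ⁆ S (A i)))))
    (c⊥ (⁅ x ⁆ △ S)
      (s≤s (ℕ.≤-trans (∣△∣≤ ⁅ x ⁆ S) (subst (λ y → y + ∣ S ∣ ≤ k) (sym (∣⁅x⁆∣≡1 x)) S<k)))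
      (2∣p+∣△∣ p ⁅ x ⁆ S (subst (λ y → Even (p + (y + ∣ S ∣))) (sym (∣⁅x⁆∣≡1 x)) (subst Even (sym (ℕ.+-suc p ∣ S ∣)) 2∣))))
    where
    regroup : ∀ a b c → a ℤ.* (b ℤ.* c) ≡ b ℤ.* a ℤ.* c
    regroup = solve-∀

  Gram : Fin N → Fin N → ℤ
  Gram i j = ∑[ x < n ] (character ⁅ x ⁆ i ℤ.* character ⁅ x ⁆ j)

  -- Characters are multiplicative in `△`, so products of coordinates of two sets are the
  -- coordinates of their symmetric difference.
  Gram-distance : ∀ i j → Gram i j ≡ pos n ℤ.- pos (2 * ∣ A i △ A j ∣)
  Gram-distance i j = trans (∑-cong {n} λ x → sym (χ-△ʳ ⁅ x ⁆ (A i) (A j))) (∑χ-singletons (A i △ A j))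

  -- The two signs are proved together: in (z - a₀) g the factor z raises the degree and twists c, while the
  -- factor - a₀ exchanges the two parities and the two signs.
  quad-annihilator-nonPos : (a : Vector ℤ t) → (∀ i → 0ℤ ℤ.≤ a i) → ∀ c → Orthogonal (suc t) t c →
    quad c (λ i j → annihilator a (Gram i j)) ℤ.≤ 0ℤ
  quad-annihilator-nonNeg : (a : Vector ℤ t) → (∀ i → 0ℤ ℤ.≤ a i) → ∀ c → Orthogonal t (suc t) c →
    0ℤ ℤ.≤ quad c (λ i j → annihilator a (Gram i j))

  quad-annihilator-nonPos {zero} a 0≤a c c⊥ = ℤ.≤-reflexive (trans (quad-one c) (cong (λ s → s ℤ.* s) ∑c≡0))
    where
    ∑c≡0 : ∑.sum c ≡ 0ℤ
    ∑c≡0 = trans (∑-cong {N} λ i → sym (trans (cong (ℤ._* c i) (χ-⊥ (A i))) (ℤ.*-identityˡ (c i))))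
      -- The empty set has even size below 1, and its character is constant, so the coefficients sum
      -- to zero.
      (c⊥ ⊥ (s≤s (ℕ.≤-reflexive (∣⊥∣≡0 n))) (divides 0 (∣⊥∣≡0 n)))
  quad-annihilator-nonPos {suc t} a 0≤a c c⊥ = subst (ℤ._≤ 0ℤ) (sym (quad-Gram (λ x → character ⁅ x ⁆) (a 0F) c _))
    (ℤ.+-mono-≤
      (∑-nonPos {n} λ x → quad-annihilator-nonPos (a ∘ Fin.suc) (0≤a ∘ Fin.suc) (twist x c) (Orthogonal-parity (Orthogonal-twist x c⊥)))
      (0≤i⇒0≤j⇒-i*j≤0 (0≤a 0F)
        -- Restricting the degrees from below `2 + t` to below `t` keeps the parity `suc t`, as the
        -- opposite sign for the shorter product demands.
        (quad-annihilator-nonNeg (a ∘ Fin.suc) (0≤a ∘ Fin.suc) c (Orthogonal-≤ (ℕ.m≤n+m t 2) c⊥))))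

  quad-annihilator-nonNeg {zero} a 0≤a c c⊥ = subst (0ℤ ℤ.≤_) (sym (quad-one c)) (0≤i*i (∑.sum c))
  quad-annihilator-nonNeg {suc t} a 0≤a c c⊥ = subst (0ℤ ℤ.≤_) (sym (quad-Gram (λ x → character ⁅ x ⁆) (a 0F) c _))
    (ℤ.+-mono-≤
      (∑-nonNeg {n} λ x → quad-annihilator-nonNeg (a ∘ Fin.suc) (0≤a ∘ Fin.suc) (twist x c) (Orthogonal-parity (Orthogonal-twist x c⊥)))
      (0≤i⇒j≤0⇒0≤-i*j (0≤a 0F)
        -- Here the degree bound `suc t` is already right, and `2 + t` and `t` prescribe the same
        -- parity.
        (quad-annihilator-nonPos (a ∘ Fin.suc) (0≤a ∘ Fin.suc) c (Orthogonal-parity c⊥))))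

-- The upper bound

∃-Orthogonal : (A : Fin N → Subset (suc m)) → ∀ t → binomialSum (suc m) t < N →
  ∃[ c ] (∃[ i ] c i ≢ 0ℤ) × Orthogonal A (suc t) t c
∃-Orthogonal {N} {m} A t B<N =
  let c , c≢0 , rows⊥c = ∃-orthogonal rows (subst (_< N) (sym length-rows) B<N)
  in c , c≢0 , λ where
    -- One equation per small tail suffices: the tail `S` has size at most `t`, and the parity
    -- condition recovers `b`.
    (b ∷ S) (s≤s S≤t) 2∣ → subst (λ T → character A T · c ≡ 0ℤ) (sym (extend-unique t b S 2∣))
      (All.lookup (All.map⁻ rows⊥c) (∈-smallSubsets⁺ S (ℕ.≤-trans (∣S∣≤∣b∷S∣ b S) S≤t)))
  where
  rows : List (Vector ℤ N)
  rows = List.map (character A ∘ extend t) (smallSubsets m t)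
  length-rows : length rows ≡ binomialSum (suc m) t
  length-rows = trans (length-map _ (smallSubsets m t)) (length-smallSubsets m t)
  ∣S∣≤∣b∷S∣ : ∀ b (S : Subset m) → ∣ S ∣ ≤ ∣ b ∷ S ∣
  ∣S∣≤∣b∷S∣ false S = ℕ.≤-refl
  ∣S∣≤∣b∷S∣ true  S = ℕ.n≤1+n ∣ S ∣

lookup-injective : ∀ {A : Set} {xs : List A} → Unique xs → ∀ i j → lookup xs i ≡ lookup xs j → i ≡ j
lookup-injective (_    ∷ _)   Fin.zero    Fin.zero    _  = refl
lookup-injective (x∉xs ∷ _)   Fin.zero    (Fin.suc j) eq = contradiction eq (All.lookup x∉xs (∈-lookup j))
lookup-injective (x∉xs ∷ _)   (Fin.suc i) Fin.zero    eq = contradiction (sym eq) (All.lookup x∉xs (∈-lookup i))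
lookup-injective (_    ∷ xs!) (Fin.suc i) (Fin.suc j) eq = cong Fin.suc (lookup-injective xs! i j eq)

size≤binomialSum : (ℓ : Fin t → ℕ) → (∀ i → ℓ i ≥ 1) → (∀ i → 2 * (2 * ℓ i) ≤ suc m) →
  (F : Family (suc m)) → DistancesIn F (Doubles ℓ) → size F ≤ binomialSum (suc m) t
size≤binomialSum {t} {m} ℓ ℓ≥1 4ℓ≤n F distances = ℕ.≮⇒≥ λ B<N →
  let c , (i , ci≢0) , c⊥ = ∃-Orthogonal A t B<N in
  ℤ.<⇒≱ (quad-diagonal-pos c (λ i j → annihilator a (Gram A i j)) off diag i ci≢0)
        -- Large `n` enters here: `4ℓ≤n` makes every root `a i` nonnegative.
        (quad-annihilator-nonPos A a (λ i → ℤ.i≤j⇒0≤j-i (ℤ.+≤+ (4ℓ≤n i))) c c⊥)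
  where
  A : Fin (size F) → Subset (suc m)
  A = lookup (Family.members F)

  a : Vector ℤ t
  a i = pos (suc m) ℤ.- pos (2 * (2 * ℓ i))

  off : ∀ i j → i ≢ j → annihilator a (Gram A i j) ≡ 0ℤ
  off i j i≢j =
    let l , d≡2ℓ = distances (∈-lookup i) (∈-lookup j) (i≢j ∘ lookup-injective (Family.distinct F) i j)
    in annihilator-root a l (trans (Gram-distance A i j) (cong (λ d → pos (suc m) ℤ.- pos (2 * d)) d≡2ℓ))

  diag : ∀ i → 0ℤ ℤ.< annihilator a (Gram A i i)
  diag i = annihilator-pos a λ l → subst (a l ℤ.<_)
    (sym (trans (Gram-distance A i i) (cong (λ d → pos (suc m) ℤ.- pos (2 * d)) (∣A△A∣≡0 (A i)))))
    -- At distance 0 the Gram kernel equals `suc m`, which exceeds every root because each `ℓ l` is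
    -- positive.
    (ℤ.+-monoʳ-< (pos (suc m)) (ℤ.neg-mono-< (ℤ.+<+ (ℕ.*-monoʳ-< 2 (ℕ.*-monoʳ-< 2 (ℓ≥1 l))))))

-- The extremal family

module _ (m t : ℕ) where

  evenBall : Family (suc m)
  evenBall = record
    { members  = List.map (extend 0) (smallSubsets m t)
    ; distinct = Unique.map⁺ Vec.∷-injectiveʳ (smallSubsets-unique m t)
    }

  evenBall-size : size evenBall ≡ binomialSum (suc m) t
  evenBall-size = trans (length-map (extend 0) (smallSubsets m t)) (length-smallSubsets m t)

  evenBall-even : Members evenBall ⊆ EvenSubcube (suc m)
  evenBall-even A∈ with S , _ , refl ← ∈-map⁻ (extend 0) A∈ = 2∣p+∣extend∣ 0 S

  -- The tails differ in at most `2 * t` places and the first coordinate adds at most one. An even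
  -- distance of at most `2 * t + 1` is at most `2 * t`.
  evenBall-distances : DistancesIn evenBall (FirstEvens t)
  evenBall-distances A∈ B∈ A≢B with ∈-map⁻ (extend 0) A∈ | ∈-map⁻ (extend 0) B∈
  ... | S , S∈ , refl | T , T∈ , refl
    with 2∣p+∣△∣ 0 (extend 0 S) (extend 0 T) (∣m∣n⇒∣m+n (2∣p+∣extend∣ 0 S) (2∣p+∣extend∣ 0 T))
  ...   | divides zero    d≡ = contradiction (∣△∣≡0⇒≡ _ _ d≡) A≢B
  -- The distance is twice `suc q`, and `FirstEvens` counts from 0, so the index is `q`.
  ...   | divides (suc q) d≡ = fromℕ< q<t , trans d≡ (trans (ℕ.*-comm (suc q) 2) (cong (λ x → 2 * suc x) (sym (toℕ-fromℕ< q<t))))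
    where
    open ℕ.≤-Reasoning
    ∣A∣≤1+∣tail∣ : (A : Subset (suc m)) → ∣ A ∣ ≤ suc ∣ Vec.tail A ∣
    ∣A∣≤1+∣tail∣ (false ∷ A) = ℕ.n≤1+n ∣ A ∣
    ∣A∣≤1+∣tail∣ (true  ∷ A) = ℕ.≤-refl
    ∣S∣≤t : ∀ {S} → S ∈ smallSubsets m t → ∣ S ∣ ≤ t
    ∣S∣≤t = All.lookup (smallSubsets-small m t)
    q<t : q < t
    q<t = ℕ.≤-pred (ℕ.*-cancelʳ-< 2 (suc q) (suc t) (begin-strict
      suc q * 2                       ≡⟨ d≡ ⟨
      ∣ extend 0 S △ extend 0 T ∣     ≤⟨ ∣A∣≤1+∣tail∣ (extend 0 S △ extend 0 T) ⟩
      suc ∣ S △ T ∣                   ≤⟨ s≤s (∣△∣≤ S T) ⟩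
      suc (∣ S ∣ + ∣ T ∣)             ≤⟨ s≤s (ℕ.+-mono-≤ (∣S∣≤t S∈) (∣S∣≤t T∈)) ⟩
      suc (t + t)                     <⟨ ℕ.n<1+n (suc (t + t)) ⟩
      2 + (t + t)                     ≡⟨ double t ⟩
      suc t * 2                       ∎))
      where
      double : ∀ t → 2 + (t + t) ≡ suc t * 2
      double = solveℕ-∀

-- The threshold for the dimension

upperBound : (f : Fin t → ℕ) → ∃[ b ] (∀ i → f i ≤ b)
upperBound {zero}  f = 0 , λ ()
upperBound {suc t} f = let b , f≤b = upperBound (f ∘ Fin.suc) in f 0F ℕ.⊔ b , λ where
  Fin.zero    → ℕ.m≤m⊔n (f 0F) b
  (Fin.suc i) → ℕ.≤-trans (f≤b i) (ℕ.m≤n⊔m (f 0F) b)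

theorem1p1 : ∀ (t : ℕ) → t ≥ 1 →
    ∀ (ℓ : Fin t → ℕ) → Injective _≡_ _≡_ ℓ → (∀ i → ℓ i ≥ 1) →
    ∃[ n₀ ]
    (∀ (n : ℕ) → n ≥ n₀ →
    ∀ (F : Family n) → Members F ⊆ EvenSubcube n → DistancesIn F (Doubles ℓ) →
    size F ≤ binomialSum n t)
    ×
    (Doubles ℓ ≐ FirstEvens t →
    ∀ (n : ℕ) → n ≥ n₀ →
    ∃[ F ] Members {n} F ⊆ EvenSubcube n × DistancesIn F (FirstEvens t) × size F ≡ binomialSum n t)
-- The bound `b` dominates every `2 * (2 * ℓ i)`; its successor also forces `n` to be positive, so
-- that a first coordinate exists.
theorem1p1 t _ ℓ _ ℓ≥1 = let b , 4ℓ≤b = upperBound (λ i → 2 * (2 * ℓ i)) in suc b ,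
  (λ where (suc m) (s≤s b≤m) F _ distances → size≤binomialSum ℓ ℓ≥1 (λ i → ℕ.≤-trans (4ℓ≤b i) (ℕ.m≤n⇒m≤1+n b≤m)) F distances) ,
  (λ where _ (suc m) _ → evenBall m t , evenBall-even m t , evenBall-distances m t , evenBall-size m t)
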